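{- For all integers $n \geq k \geq 1$ there exists an oriented graph on $n$ vertices with exactly $k$ weak kings.
   Context: An oriented graph is a digraph with no loops and no pair of symmetric arcs. For vertices $u,v$ write $u(1\text{ - }0)v$ if there is an arc from $u$ to $v$, and $u(0\text{ - }0)v$ if there is no arc between $u$ and $v$. A vertex $v$ is weakly reachable within two steps from $u$ if $u(1\text{ - }0)v$, or $u(0\text{ - }0)v$, or for some vertex $w$ one has $u(1\text{ - }0)w(1\text{ - }0)v$, or $u(1\text{ - }0)w(0\text{ - }0)v$, or $u(0\text{ - }0)w(1\text{ - }0)v$. A vertex $u$ of an oriented graph $D$ is a weak king if every other vertex of $D$ is weakly reachable within two steps from $u$. -}

module Defs where

open import Data.Fin.Base using (Fin)
open import Data.Fin.Subset using (Subset; _∈_; ∣_∣)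
open import Data.Nat.Base using (ℕ)
open import Data.Product.Base using (_×_; ∃-syntax; Σ-syntax)
open import Data.Sum.Base using (_⊎_)
open import Function.Bundles using (_⇔_)
open import Level using (0ℓ)
open import Relation.Binary.Core using (Rel)
open import Relation.Binary.Definitions using (Decidable)
open import Relation.Binary.PropositionalEquality using (_≡_; _≢_)
open import Relation.Nullary.Negation using (¬_)

-- Decidability of the arc relation makes it a genuine (finite) set of arcs;
-- classically it is no restriction.
record OrientedGraph (n : ℕ) : Set₁ where
  field
    Arc               : Rel (Fin n) 0ℓ
    arc?              : Decidable Arc
    no-loops          : ∀ u → ¬ Arc u u
    no-symmetric-arcs : ∀ u v → ¬ (Arc u v × Arc v u)

module _ {n : ℕ} (D : OrientedGraph n) where
  open OrientedGraph D

  _⟨1-0⟩_ : Rel (Fin n) 0ℓ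
  u ⟨1-0⟩ v = Arc u v

  _⟨0-0⟩_ : Rel (Fin n) 0ℓ
  u ⟨0-0⟩ v = ¬ Arc u v × ¬ Arc v u

  -- Here w may coincide with u or v; since there are no loops, such a w
  -- only ever yields u(1-0)v, which is already the first alternative.
  WeaklyReachable₂ : Rel (Fin n) 0ℓ
  WeaklyReachable₂ u v =
      u ⟨1-0⟩ v
    ⊎ u ⟨0-0⟩ v
    ⊎ ∃[ w ] ( (u ⟨1-0⟩ w × w ⟨1-0⟩ v)
             ⊎ (u ⟨1-0⟩ w × w ⟨0-0⟩ v)
             ⊎ (u ⟨0-0⟩ w × w ⟨1-0⟩ v))

  WeakKing : Fin n → Set
  WeakKing u = ∀ v → v ≢ u → WeaklyReachable₂ u v

  HasExactlyWeakKings : ℕ → Set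
  HasExactlyWeakKings k =
    Σ[ S ∈ Subset n ] (∣ S ∣ ≡ k × (∀ u → u ∈ S ⇔ WeakKing u))

{-# OPTIONS --safe #-}
module Submission where

open import Data.Fin.Base using (zero)
open import Data.Fin.Subset using (Subset; inside; _∈_; _∉_; ∣_∣; ⊥; Nonempty)
open import Data.Fin.Subset.Properties using (_∈?_; ∣⊥∣≡0)
open import Data.Nat.Base using (ℕ; suc; _≤_; z≤n; s≤s)
open import Data.Product.Base using (Σ-syntax; _×_; _,_)
open import Data.Sum.Base using (inj₁; inj₂)
open import Data.Vec.Base using (_∷_; here)
open import Function.Bundles using (mk⇔)
open import Relation.Binary.PropositionalEquality using (_≡_; refl; cong)
open import Relation.Nullary.Decidable using (yes; no; _×-dec_; ¬?; decidable-stable)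
open import Relation.Nullary.Negation using (¬_)
open import Defs

-- Given a nonempty vertex set S, put an arc from every vertex of S to every
-- vertex outside S, and no others.  Vertices of S reach everything in one weak
-- step.  A vertex outside S has no out-arcs and is non-adjacent only to vertices
-- outside S, so it never gets into S.

dominationGraph : ∀ {n} → Subset n → OrientedGraph n
dominationGraph S = record
  { Arc               = λ u v → u ∈ S × v ∉ S
  ; arc?              = λ u v → (u ∈? S) ×-dec ¬? (v ∈? S)
  ; no-loops          = λ _ (u∈S , u∉S) → u∉S u∈S
  ; no-symmetric-arcs = λ _ _ ((u∈S , _) , (_ , u∉S)) → u∉S u∈S
  }

module _ {n : ℕ} (S : Subset n) where

  ∈⇒weakKing : ∀ {u} → u ∈ S → WeakKing (dominationGraph S) u
  ∈⇒weakKing u∈S v _ with v ∈? S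
  -- Arcs only end outside `S`, so two members of `S` are non-adjacent.
  ... | yes v∈S = inj₂ (inj₁ ((λ (_ , v∉S) → v∉S v∈S) , (λ (_ , u∉S) → u∉S u∈S)))
  ... | no  v∉S = inj₁ (u∈S , v∉S)

  ∉⇒¬reaches∈ : ∀ {u v} → u ∉ S → v ∈ S → ¬ WeaklyReachable₂ (dominationGraph S) u v
  ∉⇒¬reaches∈ u∉S v∈S (inj₁ (u∈S , _))                              = u∉S u∈S
  ∉⇒¬reaches∈ u∉S v∈S (inj₂ (inj₁ (_ , ¬v→u)))                      = ¬v→u (v∈S , u∉S)
  ∉⇒¬reaches∈ u∉S v∈S (inj₂ (inj₂ (_ , inj₁ ((u∈S , _) , _))))        = u∉S u∈S
  ∉⇒¬reaches∈ u∉S v∈S (inj₂ (inj₂ (_ , inj₂ (inj₁ ((u∈S , _) , _))))) = u∉S u∈S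
  -- Here the first step is a non-adjacency, so the contradiction comes from the last arc, whose
  -- head `v` would lie outside `S`.
  ∉⇒¬reaches∈ u∉S v∈S (inj₂ (inj₂ (_ , inj₂ (inj₂ (_ , _ , v∉S)))))   = v∉S v∈S

  -- Nonemptiness supplies the target that a vertex outside `S` fails to reach; for empty `S` there
  -- are no arcs and every vertex is a weak king.
  weakKing⇒∈ : Nonempty S → ∀ {u} → WeakKing (dominationGraph S) u → u ∈ S
  weakKing⇒∈ (v , v∈S) {u} king = decidable-stable (u ∈? S) λ u∉S →
    ∉⇒¬reaches∈ u∉S v∈S (king v λ { refl → u∉S v∈S })

  dominationGraph-weakKings : Nonempty S → HasExactlyWeakKings (dominationGraph S) ∣ S ∣
  dominationGraph-weakKings ne = S , refl , λ _ → mk⇔ ∈⇒weakKing (weakKing⇒∈ ne)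

subsetOfSize : ∀ {n k} → k ≤ n → Σ[ S ∈ Subset n ] ∣ S ∣ ≡ k
subsetOfSize {n} z≤n   = ⊥ , ∣⊥∣≡0 n
subsetOfSize (s≤s k≤n) with S , ∣S∣≡k ← subsetOfSize k≤n = inside ∷ S , cong suc ∣S∣≡k

theorem7 : ∀ (n k : ℕ) → 1 ≤ k → k ≤ n → Σ[ D ∈ OrientedGraph n ] HasExactlyWeakKings D k
-- Vertex `zero` is put into the set by hand, which witnesses nonemptiness; the remaining `k`
-- members are chosen among the other `n` vertices.
theorem7 (suc n) (suc k) _ (s≤s k≤n) with S , refl ← subsetOfSize k≤n =
  dominationGraph (inside ∷ S) , dominationGraph-weakKings (inside ∷ S) (zero , here)
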